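{- Let $p$ be an odd prime, let $1\le w<p$ be an integer and $1\le N\le p$. Let $$F(w,N,p)=\#\{u\in\{0,\ldots,N-1\} : q_{p,w}(u)\equiv u\bmod p\}.$$ Then for every $\varepsilon>0$, $$F(w,N,p)\ll \frac{p^{3/2+\varepsilon}}{\gcd(w-1,p-1)},$$ where the implied constant depends only on $\varepsilon$ (and $\gcd(0,p-1)=p-1$ when $w=1$).
   Context: For an odd prime $p$ and an integer $w\ge1$, the polynomial quotient $q_{p,w}(u)$ of an integer $u\ge0$ is the unique integer with $0\le q_{p,w}(u)\le p-1$ and $q_{p,w}(u)\equiv \frac{u^w-u^{wp}}{p}\bmod p$. $A\ll B$ means $|A|\le cB$ for some constant $c>0$. -}

module Defs where

open import Data.Nat using (ℕ; _^_; _*_; NonZero)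
import Data.Nat as ℕ
open import Data.Nat.Properties using (_≟_)
open import Data.Integer using (ℤ; +_; _-_; _/ℕ_; _%ℕ_)
open import Data.List using (List; length; filter; upTo)

-- Polynomial quotient q_{p,w}(u): the integer in [0, p-1] congruent mod p to
-- (u^w - u^{wp}) / p  (exact division, since u^{wp} ≡ u^w mod p by Fermat).
q : (p w u : ℕ) → .{{_ : NonZero p}} → ℕ
q p w u = ((+ (u ^ w) - + (u ^ (w * p))) /ℕ p) %ℕ p

-- F(w,N,p) = #{ u ∈ {0,…,N-1} : q_{p,w}(u) ≡ u (mod p) }
-- (q is already reduced to [0,p-1], so "≡ u mod p" is q ≡ u % p.)
F : (w N p : ℕ) → .{{_ : NonZero p}} → ℕ
F w N p = length (filter (λ u → q p w u ≟ u ℕ.% p) (upTo N))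

{-# OPTIONS --safe #-}

-- For a fixed point u ≠ 0, q_{p,w}(u) ≡ u mod p says u^{w-1} (1 - g) ≡ p mod p²,
-- where g = u^{w(p-1)} ≡ 1 mod p; hence g mod p² depends only on u^{w-1} mod p.
-- With d = gcd(w-1, p-1) the latter is a root of y^{(p-1)/d} = 1 in F_p, which
-- leaves at most (p-1)/d classes of fixed points.  If u, v lie in one class, then
-- (uv)^{w(p-1)} mod p² is prescribed, so uv mod p determines uv mod p², hence uv
-- itself because uv < p².  The pairs of a class S therefore have at most p distinct
-- products, each factoring in p^{o(1)} ways by the divisor bound, and
-- |S| ≤ p^{1/2+o(1)}.

module Submission where

open import Defs
open import Data.Nat using (ℕ; _^_; _*_; _+_; _∸_; _≤_; _<_; NonZero; _%_)
open import Data.Nat using (zero; suc; pred; _⊔_; _/_; z≤n; s≤s; z<s; NonTrivial; ≢-nonZero; ≢-nonZero⁻¹; >-nonZero; >-nonZero⁻¹; n>1⇒nonTrivial; nonTrivial⇒n>1)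
open import Data.Nat.Primality using (Prime)
open import Data.Nat.Primality using (euclidsLemma; prime⇒nonZero; prime⇒nonTrivial; _Rough_; 2-rough; ∤⇒rough-suc; rough∧∣⇒rough; rough∧∣⇒prime; rough⇒≤)
open import Data.Nat.Primality.Factorisation using (factorise)
open import Data.Nat.GCD using (gcd)
open import Data.Nat.GCD using (gcd[m,n]∣m; gcd[m,n]∣n)
open import Data.Nat.Properties
open import Data.Nat.Divisibility using (_∣_; _∤_; divides; _∣?_; ∣-trans; m∣m*n; n∣m*n; ∣1⇒≡1; *-cancelˡ-∣; ∣⇒≤; >⇒∤)
open import Data.Nat.DivMod using (m≡m%n+[m/n]*n; m%n<n; m<n⇒m%n≡m)
open import Data.Nat.Induction using (<-rec)
open import Data.Nat.ListAction using (product)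
open import Data.Nat.ListAction.Properties using (∈⇒∣product; product-↭)
open import Data.Nat.Tactic.RingSolver using (solve-∀)
open import Data.Integer as ℤ using (ℤ; +_; 0ℤ; 1ℤ; _%ℕ_; _/ℕ_)
import Data.Integer.Properties as ℤ
import Data.Integer.Divisibility.Signed as ℤ∣
open ℤ∣ using () renaming (_∣_ to _∣ℤ_)
open import Data.Integer.DivMod using (n%ℕd<d; a≡a%ℕn+[a/ℕn]*n)
import Data.Integer.Tactic.RingSolver as ℤSolver
open import Data.List using (List; []; _∷_; [_]; _++_; length; map; filter; upTo; cartesianProductWith; cartesianProduct)
open import Data.List.Properties using (length-map; length-++; length-upTo; ++-identityʳ)
open import Data.List.Membership.Propositional using (_∈_)
open import Data.List.Membership.Propositional.Properties
open import Data.List.Relation.Binary.Permutation.Propositional using (_↭_; ↭-refl; ↭-trans; prep)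
open import Data.List.Relation.Binary.Permutation.Propositional.Properties using (shift; ↭-length; ∈-resp-↭)
open import Data.List.Relation.Binary.Subset.Propositional using (_⊆_)
open import Data.List.Relation.Unary.All as All using (All; []; _∷_)
open import Data.List.Relation.Unary.AllPairs using (AllPairs; []; _∷_)
open import Data.List.Relation.Unary.Any using (here; there)
open import Data.List.Relation.Unary.Unique.Propositional using (Unique)
open import Data.List.Relation.Unary.Unique.Propositional.Properties using (Unique[x∷xs]⇒x∉xs; upTo⁺; filter⁺; cartesianProduct⁺) renaming (map⁺ to unique-map⁺)
open import Data.Vec using (Vec; []; _∷_; replicate)
open import Data.Product using (∃-syntax)
open import Data.Product using (_×_; _,_; proj₁; proj₂)
open import Data.Sum using (inj₁; inj₂)
open import Function using (_∘_)
open import Level using (Level)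
open import Relation.Nullary using (¬_; yes; no; contradiction)
open import Relation.Binary.PropositionalEquality using (_≡_)
open import Relation.Binary.PropositionalEquality using (_≢_; refl; sym; trans; cong; cong₂; subst; subst₂; module ≡-Reasoning)

private
  variable
    ℓ ℓ′ : Level
    A : Set ℓ
    B : Set ℓ′

-- Counting in lists

-- Each `x` is moved to the front of `ys`; the other members of `xs` differ from it and so survive
-- in what is left. The list `zs` is the complement.
unique⊆⇒↭ : {xs ys : List A} → Unique xs → xs ⊆ ys → ∃[ zs ] ys ↭ xs ++ zs
unique⊆⇒↭ {xs = []}     {ys} _           _  = ys , ↭-refl
unique⊆⇒↭ {xs = x ∷ xs} {ys} u@(_ ∷ uxs) xs⊆ys
  with as , bs , refl ← ∈-∃++ (xs⊆ys (here refl))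
  = let zs , σ = unique⊆⇒↭ uxs rest
    in zs , ↭-trans (shift x as bs) (prep x σ)
  where
  rest : xs ⊆ as ++ bs
  rest y∈xs with ∈-resp-↭ (shift x as bs) (xs⊆ys (there y∈xs))
  ... | here refl = contradiction y∈xs (Unique[x∷xs]⇒x∉xs u)
  ... | there y∈  = y∈

unique⊆⇒length≤ : {xs ys : List A} → Unique xs → xs ⊆ ys → length xs ≤ length ys
unique⊆⇒length≤ {xs = xs} {ys} u xs⊆ys with zs , σ ← unique⊆⇒↭ u xs⊆ys = begin
  length xs             ≤⟨ m≤m+n _ _ ⟩
  length xs + length zs ≡⟨ length-++ xs ⟨
  length (xs ++ zs)     ≡⟨ ↭-length σ ⟨
  length ys             ∎
  where open ≤-Reasoning

-- Pigeonhole: equal lengths leave no room for the complement. This turns an injective self-map of a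
-- finite list into a permutation.
unique⊆∧length≡⇒↭ : {xs ys : List A} → Unique xs → xs ⊆ ys → length xs ≡ length ys → ys ↭ xs
unique⊆∧length≡⇒↭ {xs = xs} {ys} u xs⊆ys eq with unique⊆⇒↭ u xs⊆ys
... | [] , σ = subst (ys ↭_) (++-identityʳ xs) σ
... | z ∷ zs , σ = contradiction
  (trans eq (trans (↭-length σ) (length-++ xs)))
  (m≢1+m+n (length xs) ∘ λ eq′ → trans eq′ (+-suc (length xs) (length zs)))

-- Injectivity is asked on the list only: multiplication modulo `p` and `proj₁` on pairs, to which
-- this is applied, are not injective globally.
unique-map : {f : A → B} {xs : List A} →
  (∀ {x y} → x ∈ xs → y ∈ xs → f x ≡ f y → x ≡ y) → Unique xs → Unique (map f xs)
unique-map {xs = []}     _   _       = []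
unique-map {f = f} {xs = x ∷ xs} inj (x≢ ∷ u) =
  All.tabulate fx≢ ∷ unique-map (λ y∈ z∈ → inj (there y∈) (there z∈)) u
  where
  fx≢ : ∀ {z} → z ∈ map f xs → f x ≢ z
  fx≢ z∈ fx≡z with y , y∈ , z≡ ← ∈-map⁻ f z∈ =
    All.lookup x≢ y∈ (inj (here refl) (there y∈) (trans fx≡z z≡))

length-cartesianProductWith : ∀ {c} {C : Set c} (f : A → B → C) xs ys →
  length (cartesianProductWith f xs ys) ≡ length xs * length ys
length-cartesianProductWith f []       ys = refl
length-cartesianProductWith f (x ∷ xs) ys = trans (length-++ (map (f x) ys))
  (cong₂ _+_ (length-map (f x) ys) (length-cartesianProductWith f xs ys))

fibre : (A → ℕ) → List A → ℕ → List A
fibre f xs v = filter (λ x → f x ≟ v) xs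

-- The concatenation of the fibres over `vs` covers `xs`. Applied to pairs sorted by the residue of
-- their product and to fixed points sorted by class.
length-fibres : ∀ (f : A → ℕ) {b} vs xs → Unique xs → (∀ {x} → x ∈ xs → f x ∈ vs) →
  (∀ v → length (fibre f xs v) ≤ b) → length xs ≤ length vs * b
length-fibres f {b} vs xs u f∈vs small = begin
  length xs             ≤⟨ unique⊆⇒length≤ u (λ x∈ → covered vs x∈ (f∈vs x∈)) ⟩
  length (fibres vs)    ≤⟨ length-fibres≤ vs ⟩
  length vs * b         ∎
  where
  open ≤-Reasoning
  fibres : List ℕ → List _
  fibres []       = []
  fibres (v ∷ vs) = fibre f xs v ++ fibres vs

  covered : ∀ vs {x} → x ∈ xs → f x ∈ vs → x ∈ fibres vs
  covered (v ∷ vs) x∈ (here eq)  = ∈-++⁺ˡ (∈-filter⁺ (λ x → f x ≟ v) x∈ eq)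
  covered (v ∷ vs) x∈ (there i)  = ∈-++⁺ʳ (fibre f xs v) (covered vs x∈ i)

  length-fibres≤ : ∀ vs → length (fibres vs) ≤ length vs * b
  length-fibres≤ []       = z≤n
  length-fibres≤ (v ∷ vs) = ≤-trans (≤-reflexive (length-++ (fibre f xs v)))
    (+-mono-≤ (small v) (length-fibres≤ vs))

-- Powers and integer roots

^-distribʳ-* : ∀ m n k → (m * n) ^ k ≡ m ^ k * n ^ k
^-distribʳ-* m n zero    = refl
^-distribʳ-* m n (suc k) = trans (cong (m * n *_) (^-distribʳ-* m n k))
  ([m*n]*[o*p]≡[m*o]*[n*p] m n (m ^ k) (n ^ k))

-- The integer part of the `k`-th root takes the place of real exponents. Passing from `n` to
-- `suc n` raises it by at most one.
root : ∀ k .{{_ : NonZero k}} n → ∃[ r ] (r ^ k ≤ n × n < suc r ^ k)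
root k@(suc _) zero    = 0 , z≤n , >-nonZero⁻¹ _ {{m^n≢0 1 k}}
root k (suc n) with r , r^k≤n , n<sr^k ← root k n with suc r ^ k ≤? suc n
... | yes ok = suc r , ok , ≤-<-trans n<sr^k (^-monoˡ-< k (n<1+n (suc r)))
... | no ¬ok = r , m≤n⇒m≤1+n r^k≤n , ≰⇒> ¬ok

root-maximal : ∀ k {r m n} → n < suc r ^ k → m ^ k ≤ n → m ≤ r
root-maximal k n<sr^k m^k≤n = ≮⇒≥ λ r<m →
  <⇒≱ n<sr^k (≤-trans (^-monoˡ-≤ k r<m) m^k≤n)

n<2^n : ∀ n → n < 2 ^ n
n<2^n zero    = s≤s z≤n
n<2^n (suc n) = begin
  2 + n         ≤⟨ +-mono-≤ (>-nonZero⁻¹ (2 ^ n) {{m^n≢0 2 n}}) (n<2^n n) ⟩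
  2 ^ n + 2 ^ n ≡⟨ cong (λ k → 2 ^ n + k) (+-identityʳ (2 ^ n)) ⟨
  2 ^ suc n     ∎
  where open ≤-Reasoning

-- Writing e = c k + r with r < k, one has e + 1 ≤ k (c + 1) ≤ k 2^c.
polynomial≤exponential : ∀ k .{{_ : NonZero k}} e → suc e ^ k ≤ k ^ k * 2 ^ e
polynomial≤exponential k e = begin
  suc e ^ k               ≤⟨ ^-monoˡ-≤ k suc-e≤ ⟩
  (k * 2 ^ c) ^ k         ≡⟨ ^-distribʳ-* k (2 ^ c) k ⟩
  k ^ k * (2 ^ c) ^ k     ≡⟨ cong (k ^ k *_) (^-*-assoc 2 c k) ⟩
  k ^ k * 2 ^ (c * k)     ≤⟨ *-monoʳ-≤ (k ^ k) (^-monoʳ-≤ 2 ck≤e) ⟩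
  k ^ k * 2 ^ e           ∎
  where
  open ≤-Reasoning
  c = e / k
  ck≤e : c * k ≤ e
  ck≤e = ≤-trans (m≤n+m (c * k) (e % k)) (≤-reflexive (sym (m≡m%n+[m/n]*n e k)))
  suc-e≤ : suc e ≤ k * 2 ^ c
  suc-e≤ = begin
    suc e               ≡⟨ cong suc (m≡m%n+[m/n]*n e k) ⟩
    suc (e % k) + c * k ≤⟨ +-monoˡ-≤ (c * k) (m%n<n e k) ⟩
    suc c * k           ≡⟨ *-comm (suc c) k ⟩
    k * suc c           ≤⟨ *-monoʳ-≤ k (n<2^n c) ⟩
    k * 2 ^ c           ∎

-- The divisor bound

-- By Euclid's lemma `q` divides the cofactor of `d` in `q * x`, and can be cancelled there.
∣q*x∧q∤⇒∣x : ∀ {q d x} → Prime q → q ∤ d → d ∣ q * x → d ∣ x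
∣q*x∧q∤⇒∣x {q} {d} {x} pq q∤d (divides c eq)
  with euclidsLemma c d pq (divides x (trans (sym eq) (*-comm q x)))
... | inj₂ q∣d = contradiction q∣d q∤d
... | inj₁ (divides c′ refl) = divides c′
  (*-cancelˡ-≡ x (c′ * d) q {{prime⇒nonZero pq}} (trans eq (swap c′ q d)))
  where
  swap : ∀ a b c → a * b * c ≡ b * (a * c)
  swap = solve-∀

-- Induction on `e`: if `q` divides `d`, one factor `q` is removed from both sides; otherwise `d`
-- already divides `q ^ e * m` with the smaller exponent.
∣q^e*m : ∀ {q} → Prime q → ∀ e {m d} → d ∣ q ^ e * m →
  ∃[ i ] ∃[ d′ ] (i ≤ e × d′ ∣ m × d ≡ q ^ i * d′)
∣q^e*m pq zero {m} {d} d∣ = 0 , d , z≤n , subst (d ∣_) (*-identityˡ m) d∣ , sym (*-identityˡ d)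
∣q^e*m {q} pq (suc e) {m} {d} d∣ with q ∣? d
... | yes (divides c refl) =
  let i , d′ , i≤e , d′∣m , c≡ = ∣q^e*m pq e {m} {c}
        (*-cancelˡ-∣ q {{prime⇒nonZero pq}} (subst₂ _∣_ (*-comm c q) (*-assoc q (q ^ e) m) d∣))
  in suc i , d′ , s≤s i≤e , d′∣m ,
     trans (*-comm c q) (trans (cong (q *_) c≡) (sym (*-assoc q (q ^ i) d′)))
... | no q∤d =
  let i , d′ , i≤e , rest = ∣q^e*m pq e {m} {d}
        (∣q*x∧q∤⇒∣x pq q∤d (subst (d ∣_) (*-assoc q (q ^ e) m) d∣))
  in i , d′ , m≤n⇒m≤1+n i≤e , rest

-- A list form of an upper bound for the number of divisors: repetitions and non-divisors are
-- allowed and only weaken the bound `length ds`.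
ContainsDivisors : ℕ → List ℕ → Set
ContainsDivisors n ds = ∀ {d} → d ∣ n → d ∈ ds

divisors-q^e*m : ∀ {q} → Prime q → ∀ e {m ds} → ContainsDivisors m ds →
  ∃[ ds′ ] (ContainsDivisors (q ^ e * m) ds′ × length ds′ ≡ suc e * length ds)
divisors-q^e*m {q} pq e {m} {ds} complete =
  cartesianProductWith f (upTo (suc e)) ds , complete′ ,
  trans (length-cartesianProductWith f (upTo (suc e)) ds) (cong (_* length ds) (length-upTo (suc e)))
  where
  f : ℕ → ℕ → ℕ
  f i d = q ^ i * d
  complete′ : ContainsDivisors (q ^ e * m) (cartesianProductWith f (upTo (suc e)) ds)
  complete′ d∣ with i , d′ , i≤e , d′∣m , refl ← ∣q^e*m pq e d∣ =
    ∈-cartesianProductWith⁺ f (∈-upTo⁺ (s≤s i≤e)) (complete d′∣m)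

removePower : ∀ j .{{_ : NonTrivial j}} n → .{{NonZero n}} →
  ∃[ e ] ∃[ m ] (n ≡ j ^ e * m × j ∤ m)
removePower j n = <-rec (λ n → NonZero n → ∃[ e ] ∃[ m ] (n ≡ j ^ e * m × j ∤ m)) step n
  (≢-nonZero (≢-nonZero⁻¹ n))
  where
  step : ∀ n → (∀ {c} → c < n → NonZero c → ∃[ e ] ∃[ m ] (c ≡ j ^ e * m × j ∤ m)) →
    NonZero n → ∃[ e ] ∃[ m ] (n ≡ j ^ e * m × j ∤ m)
  step n rec nz with j ∣? n
  ... | no j∤n = 0 , n , sym (*-identityˡ n) , j∤n
  ... | yes (divides c refl) =
    let instance _ = m*n≢0⇒m≢0 c {j} {{nz}}
        e , m , c≡ , j∤m = rec (m<m*n c j (nonTrivial⇒n>1 j)) (m*n≢0⇒m≢0 c {j} {{nz}})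
    in suc e , m , trans (*-comm c j) (trans (cong (j *_) c≡) (sym (*-assoc j (j ^ e) m))) , j∤m

-- The bound `n ^ (1/k)` up to a constant for the number of divisors, restricted to `n` without
-- nontrivial divisors below `j`. This allows a descent on `j` from `2 ^ k` to 2.
RoughDivisorBound : ℕ → ℕ → Set
RoughDivisorBound k j = ∃[ C ] (∀ n → .{{NonZero n}} → j Rough n →
  ∃[ ds ] (ContainsDivisors n ds × length ds ^ k ≤ C * n))

-- A prime q ≥ 2^k pays for the at most twofold growth of the number of divisors.
largePrimes : ∀ k ps → All (λ q → Prime q × 2 ^ k ≤ q) ps →
  ∃[ ds ] (ContainsDivisors (product ps) ds × length ds ^ k ≤ product ps)
largePrimes k [] [] = [ 1 ] , (λ d∣1 → here (∣1⇒≡1 d∣1)) , ≤-reflexive (^-zeroˡ k)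
largePrimes k (q ∷ ps) ((pq , 2^k≤q) ∷ large)
  with ds , complete , small ← largePrimes k ps large
  with ds′ , complete′ , length≡ ← divisors-q^e*m pq 1 complete
  = ds′ , (λ {d} d∣ → complete′ (subst (d ∣_) (cong (_* product ps) (sym (^-identityʳ q))) d∣)) , bound
  where
  open ≤-Reasoning
  bound : length ds′ ^ k ≤ q * product ps
  bound = begin
    length ds′ ^ k         ≡⟨ cong (_^ k) length≡ ⟩
    (2 * length ds) ^ k    ≡⟨ ^-distribʳ-* 2 (length ds) k ⟩
    2 ^ k * length ds ^ k  ≤⟨ *-mono-≤ 2^k≤q small ⟩
    q * product ps         ∎

roughDivisorBound-2^k : ∀ k → RoughDivisorBound k (2 ^ k)
roughDivisorBound-2^k k = 1 , bound
  where
  bound : ∀ n → .{{NonZero n}} → (2 ^ k) Rough n →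
    ∃[ ds ] (ContainsDivisors n ds × length ds ^ k ≤ 1 * n)
  bound n rough with record { factors = ps ; isFactorisation = refl ; factorsPrime = primes } ← factorise n =
    let ds , complete , small = largePrimes k ps (All.tabulate λ q∈ps →
          All.lookup primes q∈ps ,
          rough⇒≤ {{prime⇒nonTrivial (All.lookup primes q∈ps)}} (rough∧∣⇒rough rough (∈⇒∣product q∈ps)))
    in ds , complete , ≤-trans small (≤-reflexive (sym (*-identityˡ n)))

-- Split off the full power of `j` from `n`; the cofactor is `suc j`-rough. An exponent `e`
-- multiplies the number of divisors by at most `suc e`, and `suc e ^ k ≤ k ^ k * 2 ^ e ≤ k ^ k * j
-- ^ e`, so the constant grows by `k ^ k`, uniformly in `e`.
roughDivisorBound-pred : ∀ k .{{_ : NonZero k}} j .{{_ : NonTrivial j}} →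
  RoughDivisorBound k (suc j) → RoughDivisorBound k j
roughDivisorBound-pred k j (C , bound) = k ^ k * C , bound′
  where
  open ≤-Reasoning
  swap : ∀ a b c d → a * b * (c * d) ≡ a * c * (b * d)
  swap = solve-∀
  bound′ : ∀ n → .{{NonZero n}} → j Rough n →
    ∃[ ds ] (ContainsDivisors n ds × length ds ^ k ≤ k ^ k * C * n)
  bound′ n rough with removePower j n
  ... | zero , m , refl , j∤m =
    let instance _ = m*n≢0⇒n≢0 1 {m}
        ds , complete , small = bound m (∤⇒rough-suc j∤m (rough∧∣⇒rough rough (n∣m*n 1)))
    in ds , (λ {d} d∣ → complete (subst (d ∣_) (*-identityˡ m) d∣)) , (begin
      length ds ^ k      ≤⟨ small ⟩
      C * m              ≤⟨ m≤n*m (C * m) (k ^ k) {{m^n≢0 k k}} ⟩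
      k ^ k * (C * m)    ≡⟨ *-assoc (k ^ k) C m ⟨
      k ^ k * C * m      ≡⟨ cong (k ^ k * C *_) (*-identityˡ m) ⟨
      k ^ k * C * (1 * m) ∎)
  ... | suc e , m , refl , j∤m
    with ds , complete , small ← bound m {{m*n≢0⇒n≢0 (j ^ suc e) {m}}}
           (∤⇒rough-suc j∤m (rough∧∣⇒rough rough (n∣m*n (j ^ suc e))))
    -- Here `j` divides a `j`-rough number, hence is prime.
    with ds′ , complete′ , length≡ ← divisors-q^e*m
           (rough∧∣⇒prime rough (∣-trans (m∣m*n (j ^ e)) (m∣m*n m))) (suc e) complete
    = ds′ , complete′ , (begin
      length ds′ ^ k                       ≡⟨ cong (_^ k) length≡ ⟩
      (suc (suc e) * length ds) ^ k        ≡⟨ ^-distribʳ-* (suc (suc e)) (length ds) k ⟩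
      suc (suc e) ^ k * length ds ^ k      ≤⟨ *-mono-≤ (polynomial≤exponential k (suc e)) small ⟩
      k ^ k * 2 ^ suc e * (C * m)          ≤⟨ *-monoˡ-≤ (C * m) (*-monoʳ-≤ (k ^ k)
                                                (^-monoˡ-≤ (suc e) (nonTrivial⇒n>1 j))) ⟩
      k ^ k * j ^ suc e * (C * m)          ≡⟨ swap (k ^ k) (j ^ suc e) C m ⟩
      k ^ k * C * (j ^ suc e * m)          ∎)

roughDivisorBound : ∀ k .{{_ : NonZero k}} t j .{{_ : NonTrivial j}} →
  RoughDivisorBound k (t + j) → RoughDivisorBound k j
roughDivisorBound k zero    j bound = bound
roughDivisorBound k (suc t) j bound = roughDivisorBound-pred k j
  (roughDivisorBound k t (suc j) {{n>1⇒nonTrivial (m<n⇒m<1+n (nonTrivial⇒n>1 j))}}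
    (subst (RoughDivisorBound k) (sym (+-suc t j)) bound))

-- Every number is 2-rough. The descent starts with constant 1 and gains a factor `k ^ k` at each of
-- its `2 ^ k ∸ 2` steps, so the final constant depends on `k` alone.
divisorBound : ∀ k .{{_ : NonZero k}} → ∃[ C ] (∀ n → .{{NonZero n}} →
  ∃[ ds ] (ContainsDivisors n ds × length ds ^ k ≤ C * n))
divisorBound k =
  let C , bound = roughDivisorBound k (2 ^ k ∸ 2) 2
        (subst (RoughDivisorBound k) (sym (m∸n+n≡m 2≤2^k)) (roughDivisorBound-2^k k))
  in C , λ n → bound n 2-rough
  where
  2≤2^k : 2 ≤ 2 ^ k
  2≤2^k = ≤-trans (≤-reflexive (sym (^-identityʳ 2))) (^-monoʳ-≤ 2 (>-nonZero⁻¹ k))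

-- Congruences

infix 4 _≡_[mod_]

-- The explicit quotient lets a match on `refl` substitute for `x`, after which congruence rules
-- become ring identities.
record _≡_[mod_] (x y m : ℤ) : Set where
  constructor mod-by
  field
    quot : ℤ
    eq   : x ≡ y ℤ.+ quot ℤ.* m

module _ {m : ℤ} where

  mod-reflexive : ∀ {x y} → x ≡ y → x ≡ y [mod m ]
  mod-reflexive {x} refl = mod-by 0ℤ (lemma x m)
    where
    lemma : ∀ x m → x ≡ x ℤ.+ 0ℤ ℤ.* m
    lemma = ℤSolver.solve-∀

  mod-sym : ∀ {x y} → x ≡ y [mod m ] → y ≡ x [mod m ]
  mod-sym {y = y} (mod-by q refl) = mod-by (ℤ.- q) (lemma y q m)
    where
    lemma : ∀ y q m → y ≡ y ℤ.+ q ℤ.* m ℤ.+ (ℤ.- q) ℤ.* m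
    lemma = ℤSolver.solve-∀

  mod-trans : ∀ {x y z} → x ≡ y [mod m ] → y ≡ z [mod m ] → x ≡ z [mod m ]
  mod-trans {z = z} (mod-by q refl) (mod-by r refl) = mod-by (r ℤ.+ q) (lemma z q r m)
    where
    lemma : ∀ z q r m → z ℤ.+ r ℤ.* m ℤ.+ q ℤ.* m ≡ z ℤ.+ (r ℤ.+ q) ℤ.* m
    lemma = ℤSolver.solve-∀

  mod-* : ∀ {x y x′ y′} → x ≡ y [mod m ] → x′ ≡ y′ [mod m ] → x ℤ.* x′ ≡ y ℤ.* y′ [mod m ]
  mod-* {y = y} {y′ = y′} (mod-by q refl) (mod-by r refl) =
    mod-by (q ℤ.* y′ ℤ.+ y ℤ.* r ℤ.+ q ℤ.* r ℤ.* m) (lemma y y′ q r m)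
    where
    lemma : ∀ y y′ q r m → (y ℤ.+ q ℤ.* m) ℤ.* (y′ ℤ.+ r ℤ.* m) ≡
      y ℤ.* y′ ℤ.+ (q ℤ.* y′ ℤ.+ y ℤ.* r ℤ.+ q ℤ.* r ℤ.* m) ℤ.* m
    lemma = ℤSolver.solve-∀

  mod-*ˡ : ∀ z {x y} → x ≡ y [mod m ] → z ℤ.* x ≡ z ℤ.* y [mod m ]
  mod-*ˡ z = mod-* (mod-reflexive {z} refl)

  mod-^ : ∀ {x y} k → x ≡ y [mod m ] → x ℤ.^ k ≡ y ℤ.^ k [mod m ]
  mod-^ zero    x≡y = mod-reflexive refl
  mod-^ (suc k) x≡y = mod-* x≡y (mod-^ k x≡y)

  ∣⇒mod : ∀ {x y} → m ∣ℤ x ℤ.- y → x ≡ y [mod m ]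
  ∣⇒mod {x} {y} (ℤ∣.divides q eq) = mod-by q (trans (lemma x y) (cong (ℤ._+_ y) eq))
    where
    lemma : ∀ x y → x ≡ y ℤ.+ (x ℤ.- y)
    lemma = ℤSolver.solve-∀

  mod⇒∣ : ∀ {x y} → x ≡ y [mod m ] → m ∣ℤ x ℤ.- y
  mod⇒∣ {y = y} (mod-by q refl) = ℤ∣.divides q (lemma y q m)
    where
    lemma : ∀ y q m → y ℤ.+ q ℤ.* m ℤ.- y ≡ q ℤ.* m
    lemma = ℤSolver.solve-∀

  -- Cancellability of `a` is a hypothesis on divisibility, so that one lemma serves both moduli `p`
  -- and `p²`.
  mod-cancel : ∀ a {x y} → (∀ z → m ∣ℤ a ℤ.* z → m ∣ℤ z) →
    a ℤ.* x ≡ a ℤ.* y [mod m ] → x ≡ y [mod m ]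
  mod-cancel a {x} {y} cancel ax≡ay =
    ∣⇒mod (cancel _ (subst (m ∣ℤ_) (lemma a x y) (mod⇒∣ ax≡ay)))
    where
    lemma : ∀ a x y → a ℤ.* x ℤ.- a ℤ.* y ≡ a ℤ.* (x ℤ.- y)
    lemma = ℤSolver.solve-∀

-- The distance of `a` and `b` is at most their maximum, hence a multiple of `n` below `n`.
mod-small : ∀ {a b n} → a < n → b < n → + a ≡ + b [mod + n ] → a ≡ b
mod-small {a} {b} {n} a<n b<n a≡b with ℤ.∣ + a ℤ.- + b ∣ in eq
... | zero  = ℤ.+-injective (ℤ.i-j≡0⇒i≡j (+ a) (+ b) (ℤ.∣i∣≡0⇒i≡0 eq))
... | suc d = contradiction (subst (n ∣_) eq (ℤ∣.∣⇒∣ᵤ (mod⇒∣ a≡b))) (>⇒∤ (begin-strict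
  suc d                ≡⟨ eq ⟨
  ℤ.∣ + a ℤ.- + b ∣    ≡⟨ cong ℤ.∣_∣ (ℤ.m-n≡m⊖n a b) ⟩
  ℤ.∣ a ℤ.⊖ b ∣        ≤⟨ ℤ.∣m⊝n∣≤m⊔n a b ⟩
  a ⊔ b                <⟨ ⊔-pres-<m a<n b<n ⟩
  n                    ∎))
  where open ≤-Reasoning

mod-% : ∀ a n .{{_ : NonZero n}} → + (a % n) ≡ + a [mod + n ]
mod-% a n = mod-sym (mod-by (+ (a / n)) (begin
  + a                                  ≡⟨ cong +_ (m≡m%n+[m/n]*n a n) ⟩
  + (a % n + a / n * n)                ≡⟨ ℤ.pos-+ (a % n) (a / n * n) ⟩
  + (a % n) ℤ.+ + (a / n * n)          ≡⟨ cong (ℤ._+_ (+ (a % n))) (ℤ.pos-* (a / n) n) ⟩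
  + (a % n) ℤ.+ + (a / n) ℤ.* + n      ∎))
  where open ≡-Reasoning

%-mod : ∀ {a b n} .{{_ : NonZero n}} → a % n ≡ b % n → + a ≡ + b [mod + n ]
%-mod {a} {b} {n} eq = mod-trans (mod-sym (mod-% a n)) (mod-trans (mod-reflexive (cong +_ eq)) (mod-% b n))

pos-^ : ∀ m n → + (m ^ n) ≡ (+ m) ℤ.^ n
pos-^ m zero    = refl
pos-^ m (suc n) = trans (ℤ.pos-* m (m ^ n)) (cong (ℤ._*_ (+ m)) (pos-^ m n))

^ℤ-distribʳ-* : ∀ x y k → (x ℤ.* y) ℤ.^ k ≡ x ℤ.^ k ℤ.* y ℤ.^ k
^ℤ-distribʳ-* x y zero    = refl
^ℤ-distribʳ-* x y (suc k) = trans (cong (ℤ._*_ (x ℤ.* y)) (^ℤ-distribʳ-* x y k))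
  (lemma x y (x ℤ.^ k) (y ℤ.^ k))
  where
  lemma : ∀ a b c d → a ℤ.* b ℤ.* (c ℤ.* d) ≡ a ℤ.* c ℤ.* (b ℤ.* d)
  lemma = ℤSolver.solve-∀

-- Monic polynomials; the leading coefficient 1 is not stored.

eval : ∀ {n} → Vec ℤ n → ℤ → ℤ
eval []       x = 1ℤ
eval (c ∷ cs) x = c ℤ.+ x ℤ.* eval cs x

-- Synthetic division by `x - r`: the coefficients of the quotient are the values at `r` of the
-- successive Horner tails.
divideBy : ∀ {n} → ℤ → Vec ℤ (suc n) → Vec ℤ n
divideBy r (c ∷ [])         = []
divideBy r (c ∷ cs@(_ ∷ _)) = eval cs r ∷ divideBy r cs

eval-divideBy : ∀ {n} r (cs : Vec ℤ (suc n)) x →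
  eval cs x ℤ.- eval cs r ≡ (x ℤ.- r) ℤ.* eval (divideBy r cs) x
eval-divideBy r (c ∷ []) x = lemma c x r
  where
  lemma : ∀ c x r → c ℤ.+ x ℤ.* 1ℤ ℤ.- (c ℤ.+ r ℤ.* 1ℤ) ≡ (x ℤ.- r) ℤ.* 1ℤ
  lemma = ℤSolver.solve-∀
eval-divideBy r (c ∷ cs@(_ ∷ _)) x = begin
  c ℤ.+ x ℤ.* eval cs x ℤ.- (c ℤ.+ r ℤ.* eval cs r)
    ≡⟨ lemma₁ c x r (eval cs x) (eval cs r) ⟩
  (x ℤ.- r) ℤ.* eval cs r ℤ.+ x ℤ.* (eval cs x ℤ.- eval cs r)
    ≡⟨ cong (λ t → (x ℤ.- r) ℤ.* eval cs r ℤ.+ x ℤ.* t) (eval-divideBy r cs x) ⟩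
  (x ℤ.- r) ℤ.* eval cs r ℤ.+ x ℤ.* ((x ℤ.- r) ℤ.* eval (divideBy r cs) x)
    ≡⟨ lemma₂ (x ℤ.- r) x (eval cs r) (eval (divideBy r cs) x) ⟩
  (x ℤ.- r) ℤ.* (eval cs r ℤ.+ x ℤ.* eval (divideBy r cs) x)    ∎
  where
  open ≡-Reasoning
  lemma₁ : ∀ c x r f g → c ℤ.+ x ℤ.* f ℤ.- (c ℤ.+ r ℤ.* g) ≡ (x ℤ.- r) ℤ.* g ℤ.+ x ℤ.* (f ℤ.- g)
  lemma₁ = ℤSolver.solve-∀
  lemma₂ : ∀ d x g h → d ℤ.* g ℤ.+ x ℤ.* (d ℤ.* h) ≡ d ℤ.* (g ℤ.+ x ℤ.* h)
  lemma₂ = ℤSolver.solve-∀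

eval-x^n : ∀ n x → eval (replicate n 0ℤ) x ≡ x ℤ.^ n
eval-x^n zero    x = refl
eval-x^n (suc n) x = trans (ℤ.+-identityˡ _) (cong (ℤ._*_ x) (eval-x^n n x))

-- Cancellation modulo a prime and its square.

module _ {p : ℕ} (pr : Prime p) where

  private
    instance
      p≢0 : NonZero p
      p≢0 = prime⇒nonZero pr

    P P² : ℤ
    P  = + p
    P² = P ℤ.* P

  p∤1 : ¬ P ∣ℤ 1ℤ
  p∤1 p∣1 = >⇒∤ (nonTrivial⇒n>1 p {{prime⇒nonTrivial pr}}) (ℤ∣.∣⇒∣ᵤ p∣1)

  p∤small : ∀ {u} → 0 < u → u < p → ¬ P ∣ℤ + u
  p∤small {suc _} _ u<p p∣u = >⇒∤ u<p (ℤ∣.∣⇒∣ᵤ p∣u)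

  cancel-p : ∀ {a} → ¬ P ∣ℤ a → ∀ x → P ∣ℤ a ℤ.* x → P ∣ℤ x
  cancel-p {a} p∤a x p∣ax with euclidsLemma ℤ.∣ a ∣ ℤ.∣ x ∣ pr
    (subst (p ∣_) (ℤ.abs-* a x) (ℤ∣.∣⇒∣ᵤ p∣ax))
  ... | inj₁ p∣a = contradiction (ℤ∣.∣ᵤ⇒∣ p∣a) p∤a
  ... | inj₂ p∣x = ℤ∣.∣ᵤ⇒∣ p∣x

  -- Two applications of `cancel-p`: the first gives `x = c * p`, and after division by `p` the
  -- second shows that `p` divides `c`.
  cancel-p² : ∀ {a} → ¬ P ∣ℤ a → ∀ x → P² ∣ℤ a ℤ.* x → P² ∣ℤ x
  cancel-p² {a} p∤a x p²∣ax
    with cancel-p p∤a x (ℤ∣.∣-trans (ℤ∣.∣m⇒∣m*n P ℤ∣.∣-refl) p²∣ax)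
  ... | ℤ∣.divides c refl = ℤ∣.*-monoˡ-∣ P (cancel-p p∤a c
    (ℤ∣.*-cancelʳ-∣ P {P} {a ℤ.* c} (subst (P² ∣ℤ_) (sym (ℤ.*-assoc a c P)) p²∣ax)))

  p∤* : ∀ {x y} → ¬ P ∣ℤ x → ¬ P ∣ℤ y → ¬ P ∣ℤ x ℤ.* y
  p∤* p∤x p∤y p∣xy = p∤y (cancel-p p∤x _ p∣xy)

  p∤^ : ∀ {x} → ¬ P ∣ℤ x → ∀ k → ¬ P ∣ℤ x ℤ.^ k
  p∤^ p∤x zero    = p∤1
  p∤^ p∤x (suc k) = p∤* p∤x (p∤^ p∤x k)

  p∤product : ∀ xs → All (λ x → ¬ P ∣ℤ + x) xs → ¬ P ∣ℤ + product xs
  p∤product []       []         = p∤1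
  p∤product (x ∷ xs) (p∤x ∷ p∤) = subst (¬_ ∘ (P ∣ℤ_)) (sym (ℤ.pos-* x (product xs)))
    (p∤* p∤x (p∤product xs p∤))

  -- Fermat's little theorem

  residues : List ℕ
  residues = map suc (upTo (p ∸ 1))

  residues⁺ : ∀ {u} → 0 < u → u < p → u ∈ residues
  residues⁺ {suc u} _ u<p = ∈-map⁺ suc (∈-upTo⁺ (∸-monoˡ-≤ 1 u<p))

  residues⁻ : ∀ {u} → u ∈ residues → 0 < u × u < p
  residues⁻ u∈ with i , i∈ , refl ← ∈-map⁻ suc u∈ =
    z<s , subst (suc i <_) (m+[n∸m]≡n (>-nonZero⁻¹ p)) (s≤s (∈-upTo⁻ i∈))

  product-scaled : ∀ a ys →
    + product (map (λ i → a * i % p) ys) ≡ (+ a) ℤ.^ length ys ℤ.* + product ys [mod P ]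
  product-scaled a []       = mod-reflexive refl
  product-scaled a (y ∷ ys) = mod-trans (mod-reflexive (ℤ.pos-* (a * y % p) _))
    (mod-trans (mod-* (mod-trans (mod-% (a * y) p) (mod-reflexive (ℤ.pos-* a y))) (product-scaled a ys))
      (mod-reflexive (trans (lemma (+ a) (+ y) ((+ a) ℤ.^ length ys) (+ product ys))
        (cong (ℤ._*_ ((+ a) ℤ.^ suc (length ys))) (sym (ℤ.pos-* y (product ys)))))))
    where
    lemma : ∀ a y b z → a ℤ.* y ℤ.* (b ℤ.* z) ≡ a ℤ.* b ℤ.* (y ℤ.* z)
    lemma = ℤSolver.solve-∀

  -- Multiplication by a permutes the nonzero residues, so it preserves their product.
  fermat : ∀ {a} → ¬ P ∣ℤ + a → (+ a) ℤ.^ (p ∸ 1) ≡ 1ℤ [mod P ]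
  fermat {a} p∤a = mod-cancel (+ product residues) (cancel-p (p∤product residues (All.tabulate p∤residue)))
    (mod-trans
    (mod-reflexive (ℤ.*-comm (+ product residues) ((+ a) ℤ.^ (p ∸ 1))))
    (mod-trans (mod-sym (subst
      (λ l → + product (map scale residues) ≡ (+ a) ℤ.^ l ℤ.* + product residues [mod P ])
      length-residues (product-scaled a residues)))
    (mod-reflexive (trans (cong +_ (sym (product-↭ permuted))) (sym (ℤ.*-identityʳ (+ product residues)))))))
    where
    length-residues : length residues ≡ p ∸ 1
    length-residues = trans (length-map suc (upTo (p ∸ 1))) (length-upTo (p ∸ 1))
    scale : ℕ → ℕ
    scale i = a * i % p
    p∤residue : ∀ {u} → u ∈ residues → ¬ P ∣ℤ + u
    p∤residue u∈ = let 0<u , u<p = residues⁻ u∈ in p∤small 0<u u<p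
    scale-mod : ∀ i → + scale i ≡ + a ℤ.* + i [mod P ]
    scale-mod i = mod-trans (mod-% (a * i) p) (mod-reflexive (ℤ.pos-* a i))
    scale-injective : ∀ {i j} → i ∈ residues → j ∈ residues → scale i ≡ scale j → i ≡ j
    scale-injective {i} {j} i∈ j∈ eq = mod-small (proj₂ (residues⁻ i∈)) (proj₂ (residues⁻ j∈))
      (mod-cancel (+ a) (cancel-p p∤a) (mod-trans (mod-sym (scale-mod i))
        (mod-trans (mod-reflexive (cong +_ eq)) (scale-mod j))))
    scale-residue : map scale residues ⊆ residues
    scale-residue y∈ with i , i∈ , refl ← ∈-map⁻ scale y∈ = residues⁺ (n≢0⇒n>0 nonzero) (m%n<n (a * i) p)
      where
      nonzero : scale i ≢ 0
      nonzero eq = p∤* p∤a (p∤residue i∈) (subst (P ∣ℤ_) (ℤ.+-identityʳ _)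
        (mod⇒∣ (mod-trans (mod-sym (scale-mod i)) (mod-reflexive (cong +_ eq)))))
    -- Scaling is injective on the residues and maps them to residues, so it permutes them.
    permuted = unique⊆∧length≡⇒↭
      (unique-map {f = scale} scale-injective (unique-map⁺ suc-injective (upTo⁺ (p ∸ 1))))
      scale-residue (length-map scale residues)

  -- Lagrange's theorem on roots of polynomials

  -- After division by `x - r`, the roots incongruent to `r` remain roots of the quotient, because
  -- `p` is prime. In degree 0 the monic polynomial is the constant 1, which has no root.
  rootCount : ∀ {n} (cs : Vec ℤ n) (xs : List ℤ) → AllPairs (λ x y → ¬ x ≡ y [mod P ]) xs →
    All (λ x → P ∣ℤ eval cs x) xs → length xs ≤ n
  rootCount cs       []       _ _ = z≤n
  rootCount []       (x ∷ xs) _ (p∣1 ∷ _) = contradiction p∣1 p∤1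
  rootCount (c ∷ cs) (r ∷ xs) (r≢ ∷ distinct) (root-r ∷ roots) =
    s≤s (rootCount (divideBy r (c ∷ cs)) xs distinct (All.zipWith quotient-root (r≢ , roots)))
    where
    quotient-root : ∀ {x} → ¬ r ≡ x [mod P ] × P ∣ℤ eval (c ∷ cs) x → P ∣ℤ eval (divideBy r (c ∷ cs)) x
    quotient-root {x} (r≢x , root-x) = cancel-p (r≢x ∘ mod-sym ∘ ∣⇒mod) _
      (subst (P ∣ℤ_) (eval-divideBy r (c ∷ cs) x) (ℤ∣.∣m∣n⇒∣m-n root-x root-r))

  rootsOfUnity : ℕ → List ℕ
  rootsOfUnity m = filter (λ y → y ^ m % p ≟ 1 % p) (upTo p)

  rootsOfUnity⁺ : ∀ {m u} → u < p → (+ u) ℤ.^ m ≡ 1ℤ [mod P ] → u ∈ rootsOfUnity m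
  rootsOfUnity⁺ {m} {u} u<p u^m≡1 = ∈-filter⁺ (λ y → y ^ m % p ≟ 1 % p) (∈-upTo⁺ u<p)
    (mod-small (m%n<n (u ^ m) p) (m%n<n 1 p)
      (mod-trans (mod-% (u ^ m) p) (mod-trans (mod-reflexive (pos-^ u m))
        (mod-trans u^m≡1 (mod-sym (mod-% 1 p))))))

  length-rootsOfUnity : ∀ m .{{_ : NonZero m}} → length (rootsOfUnity m) ≤ m
  length-rootsOfUnity (suc m) = ≤-trans (≤-reflexive (sym (length-map +_ rs)))
    -- With the leading coefficient implicit, this vector is the polynomial `x ^ suc m - 1`.
    (rootCount (ℤ.- 1ℤ ∷ replicate m 0ℤ) (map +_ rs) (distinct rs rs<p rs-unique) (All.tabulate isRoot))
    where
    rs = rootsOfUnity (suc m)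
    rs-unique = filter⁺ (λ y → y ^ suc m % p ≟ 1 % p) (upTo⁺ p)
    rs⁻ : ∀ {u} → u ∈ rs → u ∈ upTo p × u ^ suc m % p ≡ 1 % p
    rs⁻ = ∈-filter⁻ (λ y → y ^ suc m % p ≟ 1 % p) {xs = upTo p}
    rs<p : All (_< p) rs
    rs<p = All.tabulate (∈-upTo⁻ ∘ proj₁ ∘ rs⁻)
    distinct : ∀ xs → All (_< p) xs → Unique xs → AllPairs (λ x y → ¬ x ≡ y [mod P ]) (map +_ xs)
    distinct []       _ _ = []
    distinct (x ∷ xs) (x<p ∷ xs<p) (x≢ ∷ u) =
      All.tabulate x≢′ ∷ distinct xs xs<p u
      where
      x≢′ : ∀ {z} → z ∈ map +_ xs → ¬ + x ≡ z [mod P ]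
      x≢′ z∈ x≡z with y , y∈ , refl ← ∈-map⁻ +_ z∈ =
        All.lookup x≢ y∈ (mod-small x<p (All.lookup xs<p y∈) x≡z)
    isRoot : ∀ {x} → x ∈ map +_ rs → P ∣ℤ eval (ℤ.- 1ℤ ∷ replicate m 0ℤ) x
    isRoot x∈ with u , u∈ , refl ← ∈-map⁻ +_ x∈ =
      subst (P ∣ℤ_) (trans (ℤ.+-comm (+ (u ^ suc m)) (ℤ.- 1ℤ))
          (cong (ℤ._+_ (ℤ.- 1ℤ)) (trans (pos-^ u (suc m)) (cong (ℤ._*_ (+ u)) (sym (eval-x^n m (+ u)))))))
        (mod⇒∣ (%-mod {u ^ suc m} {1} (proj₂ (rs⁻ u∈))))

  -- Powers modulo p²

  -- The binomial expansion to first order; the terms with `(q * P) ^ 2` vanish modulo `p²`.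
  binomial-mod-p² : ∀ y q w → (y ℤ.+ q ℤ.* P) ℤ.^ suc w ≡
    y ℤ.^ suc w ℤ.+ + suc w ℤ.* y ℤ.^ w ℤ.* (q ℤ.* P) [mod P² ]
  binomial-mod-p² y q zero    = mod-reflexive (lemma y (q ℤ.* P))
    where
    lemma : ∀ y z → (y ℤ.+ z) ℤ.* 1ℤ ≡ y ℤ.* 1ℤ ℤ.+ 1ℤ ℤ.* 1ℤ ℤ.* z
    lemma = ℤSolver.solve-∀
  binomial-mod-p² y q (suc w) = mod-trans
    (mod-*ˡ (y ℤ.+ q ℤ.* P) (binomial-mod-p² y q w))
    (mod-by (+ suc w ℤ.* y ℤ.^ w ℤ.* q ℤ.* q) (lemma y q P (+ suc w) (y ℤ.^ w)))
    where
    lemma : ∀ y q P W Y → (y ℤ.+ q ℤ.* P) ℤ.* (y ℤ.* Y ℤ.+ W ℤ.* Y ℤ.* (q ℤ.* P)) ≡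
      y ℤ.* (y ℤ.* Y) ℤ.+ (1ℤ ℤ.+ W) ℤ.* (y ℤ.* Y) ℤ.* (q ℤ.* P) ℤ.+ W ℤ.* Y ℤ.* q ℤ.* q ℤ.* (P ℤ.* P)
    lemma = ℤSolver.solve-∀

  -- For exponent `p` the linear term of the expansion contains one factor `p` from the exponent and
  -- one from `q * P`.
  mod-p⇒^p-mod-p² : ∀ {x y} → x ≡ y [mod P ] → x ℤ.^ p ≡ y ℤ.^ p [mod P² ]
  mod-p⇒^p-mod-p² {y = y} (mod-by q refl) = subst (λ n → (y ℤ.+ q ℤ.* P) ℤ.^ n ≡ y ℤ.^ n [mod P² ])
    (suc-pred p) (mod-trans (binomial-mod-p² y q r)
      (mod-by (y ℤ.^ r ℤ.* q) (trans
        (cong (λ n → y ℤ.^ suc r ℤ.+ + n ℤ.* y ℤ.^ r ℤ.* (q ℤ.* P)) (suc-pred p))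
        (cong (ℤ._+_ (y ℤ.^ suc r)) (lemma P (y ℤ.^ r) q)))))
    where
    r = pred p
    lemma : ∀ P Y q → P ℤ.* Y ℤ.* (q ℤ.* P) ≡ Y ℤ.* q ℤ.* (P ℤ.* P)
    lemma = ℤSolver.solve-∀

  -- Uniqueness as in Hensel's lemma: the linear term has coefficient `suc w * y ^ w`, a unit
  -- because `suc w < p`, so `q * P` itself vanishes modulo `p²`.
  ^w-mod-p²⇒mod-p² : ∀ {x y} w → suc w < p → ¬ P ∣ℤ y → x ≡ y [mod P ] →
    x ℤ.^ suc w ≡ y ℤ.^ suc w [mod P² ] → x ≡ y [mod P² ]
  ^w-mod-p²⇒mod-p² {y = y} w w<p p∤y (mod-by q refl) x^w≡y^w =
    ∣⇒mod (subst (P² ∣ℤ_) (sym (lemma y (q ℤ.* P)))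
      (cancel-p² (p∤* (p∤small z<s w<p) (p∤^ p∤y w)) (q ℤ.* P)
        (subst (P² ∣ℤ_) (lemma (y ℤ.^ suc w) _)
          (mod⇒∣ (mod-trans (mod-sym (binomial-mod-p² y q w)) x^w≡y^w)))))
    where
    lemma : ∀ y z → y ℤ.+ z ℤ.- y ≡ z
    lemma = ℤSolver.solve-∀

  -- Fixed points of the polynomial quotient: the exponent w of the paper is suc w here.

  module _ (w : ℕ) where

    G : ℤ → ℤ
    G x = x ℤ.^ (suc w * (p ∸ 1))

    ^-split : ∀ x → x ℤ.^ (suc w * p) ≡ x ℤ.^ suc w ℤ.* G x
    ^-split x = trans
      (cong (x ℤ.^_) (trans (cong (suc w *_) (sym (m+[n∸m]≡n (>-nonZero⁻¹ p)))) (*-suc (suc w) (p ∸ 1))))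
      (ℤ.^-distribˡ-+-* x (suc w) (suc w * (p ∸ 1)))

    G≡1 : ∀ {u} → ¬ P ∣ℤ + u → G (+ u) ≡ 1ℤ [mod P ]
    G≡1 {u} p∤u = mod-trans
      (mod-reflexive (trans (cong ((+ u) ℤ.^_) (*-comm (suc w) (p ∸ 1)))
        (sym (ℤ.^-*-assoc (+ u) (p ∸ 1) (suc w)))))
      (mod-trans (mod-^ (suc w) (fermat p∤u)) (mod-reflexive (ℤ.^-zeroˡ (suc w))))

    -- The fixed point equation says `u ^ suc w - u ^ suc w * G u ≡ p * u` modulo `p²`. The field
    -- `fixed` is this congruence with one factor `u` cancelled, which requires `u` to be nonzero
    -- modulo `p`.
    record FixedPoint (u : ℕ) : Set where
      field
        0<u : 0 < u
        u<p : u < p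
        fixed : (+ u) ℤ.^ w ≡ (+ u) ℤ.^ w ℤ.* G (+ u) ℤ.+ P [mod P² ]
      p∤u : ¬ P ∣ℤ + u
      p∤u = p∤small 0<u u<p
    open FixedPoint

    -- Undoes the division in `q`. By Fermat `p` divides `Z`, so `Z = X * p` exactly; since `X` has
    -- remainder `u`, this is `u * p` modulo `p²`, and `u` cancels.
    fixedPoint : ∀ {u} → 0 < u → u < p → q p (suc w) u ≡ u % p → FixedPoint u
    fixedPoint {u} 0<u u<p q≡u = record { 0<u = 0<u ; u<p = u<p ; fixed = fixed′ }
      where
      open ≡-Reasoning
      x Z X : ℤ
      x = + u
      Z = + (u ^ suc w) ℤ.- + (u ^ (suc w * p))
      X = Z /ℕ p
      Z≡ : Z ≡ x ℤ.^ suc w ℤ.- x ℤ.^ suc w ℤ.* G x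
      Z≡ = cong₂ ℤ._-_ (pos-^ u (suc w)) (trans (pos-^ u (suc w * p)) (^-split x))
      p∣Z : P ∣ℤ Z
      p∣Z = subst (P ∣ℤ_) (sym Z≡) (mod⇒∣ (mod-sym (mod-trans
        (mod-*ˡ (x ℤ.^ suc w) (G≡1 (p∤small 0<u u<p))) (mod-reflexive (ℤ.*-identityʳ (x ℤ.^ suc w))))))
      Z%p≡0 : Z %ℕ p ≡ 0
      Z%p≡0 = mod-small (n%ℕd<d Z p) (>-nonZero⁻¹ p) (mod-trans (mod-sym (mod-by X (a≡a%ℕn+[a/ℕn]*n Z p)))
        (∣⇒mod (subst (P ∣ℤ_) (sym (ℤ.+-identityʳ Z)) p∣Z)))
      X≡u : X ≡ x ℤ.+ (X /ℕ p) ℤ.* P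
      X≡u = trans (a≡a%ℕn+[a/ℕn]*n X p) (cong (λ n → + n ℤ.+ (X /ℕ p) ℤ.* P) (trans q≡u (m<n⇒m%n≡m u<p)))
      Z≡pu : Z ≡ (x ℤ.+ (X /ℕ p) ℤ.* P) ℤ.* P
      Z≡pu = begin
        Z                        ≡⟨ a≡a%ℕn+[a/ℕn]*n Z p ⟩
        + (Z %ℕ p) ℤ.+ X ℤ.* P   ≡⟨ cong (λ n → + n ℤ.+ X ℤ.* P) Z%p≡0 ⟩
        0ℤ ℤ.+ X ℤ.* P           ≡⟨ ℤ.+-identityˡ _ ⟩
        X ℤ.* P                  ≡⟨ cong (ℤ._* P) X≡u ⟩
        (x ℤ.+ (X /ℕ p) ℤ.* P) ℤ.* P ∎
      lemma₁ : ∀ x A G → x ℤ.* A ≡ x ℤ.* A ℤ.* G ℤ.+ (x ℤ.* A ℤ.- x ℤ.* A ℤ.* G)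
      lemma₁ = ℤSolver.solve-∀
      lemma₂ : ∀ x A G P k → x ℤ.* A ℤ.* G ℤ.+ (x ℤ.+ k ℤ.* P) ℤ.* P ≡
        x ℤ.* (A ℤ.* G ℤ.+ P) ℤ.+ k ℤ.* (P ℤ.* P)
      lemma₂ = ℤSolver.solve-∀
      fixed′ : x ℤ.^ w ≡ x ℤ.^ w ℤ.* G x ℤ.+ P [mod P² ]
      fixed′ = mod-cancel x (cancel-p² (p∤small 0<u u<p)) (mod-by (X /ℕ p)
        (trans (lemma₁ x (x ℤ.^ w) (G x))
        (trans (cong (ℤ._+_ (x ℤ.^ suc w ℤ.* G x)) (trans (sym Z≡) Z≡pu))
        (lemma₂ x (x ℤ.^ w) (G x) P (X /ℕ p)))))

    -- Put `A = u ^ w`, `B = v ^ w`, `A = B + a p`, `G = G u`, `H = G v`. Modulo `p²`, `A G ≡ A - p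
    -- = B - p + a p ≡ B H + a p ≡ B H + a p H = A H`, where `a
    -- p` may be multiplied by `H` because `H ≡ 1` modulo `p`. The unit `A` then cancels.
    G-determined : ∀ {u v} → FixedPoint u → FixedPoint v →
      (+ u) ℤ.^ w ≡ (+ v) ℤ.^ w [mod P ] → G (+ u) ≡ G (+ v) [mod P² ]
    G-determined {u} {v} fu fv A≡B = mod-cancel ((+ u) ℤ.^ w) (cancel-p² (p∤^ (p∤u fu) w))
      (claim A≡B (G≡1 (p∤u fv)) (fixed fu) (fixed fv))
      where
      claim : ∀ {A B G H} → A ≡ B [mod P ] → H ≡ 1ℤ [mod P ] → A ≡ A ℤ.* G ℤ.+ P [mod P² ] →
        B ≡ B ℤ.* H ℤ.+ P [mod P² ] → A ℤ.* G ≡ A ℤ.* H [mod P² ]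
      claim {A} {B} {G} {H} (mod-by a e₁) (mod-by b e₂) (mod-by d e₃) (mod-by c e₄) =
        -- The multiples `c` and `d` of `p²` come from the two fixed point congruences, and `a * b`
        -- from replacing `a p` by `a p H`.
        mod-by (c ℤ.- d ℤ.- a ℤ.* b) (begin
          A ℤ.* G
            ≡⟨ l₁ (A ℤ.* G) P d ⟩
          A ℤ.* G ℤ.+ P ℤ.+ d ℤ.* P² ℤ.- P ℤ.- d ℤ.* P²
            ≡⟨ cong (λ t → t ℤ.- P ℤ.- d ℤ.* P²) (trans (sym e₃) (trans e₁ (cong (ℤ._+ a ℤ.* P) e₄))) ⟩
          B ℤ.* H ℤ.+ P ℤ.+ c ℤ.* P² ℤ.+ a ℤ.* P ℤ.- P ℤ.- d ℤ.* P²
            ≡⟨ l₂ (B ℤ.* H) P a b c d ⟩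
          B ℤ.* H ℤ.+ a ℤ.* P ℤ.* (1ℤ ℤ.+ b ℤ.* P) ℤ.+ (c ℤ.- d ℤ.- a ℤ.* b) ℤ.* P²
            ≡⟨ cong (λ t → B ℤ.* H ℤ.+ a ℤ.* P ℤ.* t ℤ.+ (c ℤ.- d ℤ.- a ℤ.* b) ℤ.* P²) (sym e₂) ⟩
          B ℤ.* H ℤ.+ a ℤ.* P ℤ.* H ℤ.+ (c ℤ.- d ℤ.- a ℤ.* b) ℤ.* P²
            ≡⟨ cong (ℤ._+ (c ℤ.- d ℤ.- a ℤ.* b) ℤ.* P²) (sym (ℤ.*-distribʳ-+ H B (a ℤ.* P))) ⟩
          (B ℤ.+ a ℤ.* P) ℤ.* H ℤ.+ (c ℤ.- d ℤ.- a ℤ.* b) ℤ.* P²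
            ≡⟨ cong (λ t → t ℤ.* H ℤ.+ (c ℤ.- d ℤ.- a ℤ.* b) ℤ.* P²) (sym e₁) ⟩
          A ℤ.* H ℤ.+ (c ℤ.- d ℤ.- a ℤ.* b) ℤ.* P² ∎)
        where
        open ≡-Reasoning
        l₁ : ∀ x P d → x ≡ x ℤ.+ P ℤ.+ d ℤ.* (P ℤ.* P) ℤ.- P ℤ.- d ℤ.* (P ℤ.* P)
        l₁ = ℤSolver.solve-∀
        l₂ : ∀ x P a b c d → x ℤ.+ P ℤ.+ c ℤ.* (P ℤ.* P) ℤ.+ a ℤ.* P ℤ.- P ℤ.- d ℤ.* (P ℤ.* P) ≡
          x ℤ.+ a ℤ.* P ℤ.* (1ℤ ℤ.+ b ℤ.* P) ℤ.+ (c ℤ.- d ℤ.- a ℤ.* b) ℤ.* (P ℤ.* P)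
        l₂ = ℤSolver.solve-∀

    -- With n = uv and n′ = u′v′: n ≡ n′ mod p gives n^{wp} ≡ n′^{wp} mod p²,
    -- and dividing by the equal factors G leaves n^w ≡ n′^w mod p².
    product-determined : suc w < p → ∀ {u v u′ v′} →
      FixedPoint u → FixedPoint v → FixedPoint u′ → FixedPoint v′ →
      G (+ u) ≡ G (+ u′) [mod P² ] → G (+ v) ≡ G (+ v′) [mod P² ] →
      u * v % p ≡ u′ * v′ % p → u * v ≡ u′ * v′
    product-determined w<p {u} {v} {u′} {v′} fu fv fu′ fv′ Gu Gv eq =
      mod-small (*-mono-< (u<p fu) (u<p fv)) (*-mono-< (u<p fu′) (u<p fv′))
        (subst₂ (λ a b → a ≡ b [mod + (p * p) ]) (sym (ℤ.pos-* u v)) (sym (ℤ.pos-* u′ v′))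
          (subst (λ m → n ≡ n′ [mod m ]) (sym (ℤ.pos-* p p))
            (^w-mod-p²⇒mod-p² w w<p p∤n′ n≡n′ n^w≡n′^w)))
      where
      n n′ : ℤ
      n  = + u ℤ.* + v
      n′ = + u′ ℤ.* + v′
      p∤n : ¬ P ∣ℤ n
      p∤n = p∤* (p∤u fu) (p∤u fv)
      p∤n′ : ¬ P ∣ℤ n′
      p∤n′ = p∤* (p∤u fu′) (p∤u fv′)
      n≡n′ : n ≡ n′ [mod P ]
      n≡n′ = subst₂ (λ a b → a ≡ b [mod P ]) (ℤ.pos-* u v) (ℤ.pos-* u′ v′) (%-mod {u * v} {u′ * v′} eq)
      k = suc w * (p ∸ 1)
      Gn : G n ≡ G n′ [mod P² ]
      Gn = mod-trans (mod-reflexive (^ℤ-distribʳ-* (+ u) (+ v) k))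
        (mod-trans (mod-* Gu Gv) (mod-reflexive (sym (^ℤ-distribʳ-* (+ u′) (+ v′) k))))
      split : ∀ x → (x ℤ.^ p) ℤ.^ suc w ≡ G x ℤ.* x ℤ.^ suc w
      split x = trans (ℤ.^-*-assoc x p (suc w)) (trans (cong (x ℤ.^_) (*-comm p (suc w)))
        (trans (^-split x) (ℤ.*-comm _ (G x))))
      n^w≡n′^w : n ℤ.^ suc w ≡ n′ ℤ.^ suc w [mod P² ]
      n^w≡n′^w = mod-cancel (G n) (cancel-p² (p∤^ p∤n k))
        (mod-trans (mod-reflexive (sym (split n)))
        (mod-trans (mod-^ (suc w) (mod-p⇒^p-mod-p² n≡n′))
        (mod-trans (mod-reflexive (split n′)) (mod-* (mod-sym Gn) (mod-reflexive {x = n′ ℤ.^ suc w} refl)))))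

-- Size and number of the classes of fixed points.

module _ {p w : ℕ} (pr : Prime p) (w<p : suc w < p) where

  private
    instance
      _ = prime⇒nonZero pr

  open FixedPoint

  -- Sort the ordered pairs from `S` by `u * v % p`. By `product-determined` each of the `p` fibres
  -- has only one product, which has at most `b` divisors.
  length-class : ∀ {b} S → Unique S → (∀ {u} → u ∈ S → FixedPoint pr w u) →
    (∀ {u v} → u ∈ S → v ∈ S → (+ u) ℤ.^ w ≡ (+ v) ℤ.^ w [mod + p ]) →
    (∀ n → .{{NonZero n}} → n ≤ p * p → ∃[ ds ] (ContainsDivisors n ds × length ds ≤ b)) →
    length S * length S ≤ p * b
  length-class {b} S unique fixed same divisors = begin
    length S * length S        ≡⟨ length-cartesianProductWith _,_ S S ⟨
    length pairs               ≤⟨ length-fibres f (upTo p) pairs pairs-unique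
                                    (λ {(u , v)} _ → ∈-upTo⁺ (m%n<n (u * v) p)) small-fibre ⟩
    length (upTo p) * b        ≡⟨ cong (_* b) (length-upTo p) ⟩
    p * b                      ∎
    where
    open ≤-Reasoning
    f : ℕ × ℕ → ℕ
    f (u , v) = u * v % p
    pairs : List (ℕ × ℕ)
    pairs = cartesianProduct S S
    pairs-unique : Unique pairs
    pairs-unique = cartesianProduct⁺ unique unique
    fibre⁻ : ∀ r {u v} → (u , v) ∈ fibre f pairs r → u ∈ S × v ∈ S × u * v % p ≡ r
    fibre⁻ r uv∈ =
      let uv∈pairs , eq = ∈-filter⁻ (λ x → f x ≟ r) {xs = pairs} uv∈
          u∈ , v∈ = ∈-cartesianProduct⁻ S S uv∈pairs
      in u∈ , v∈ , eq
    equal-products : ∀ r {u v u′ v′} → (u , v) ∈ fibre f pairs r → (u′ , v′) ∈ fibre f pairs r →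
      u * v ≡ u′ * v′
    equal-products r uv∈ uv′∈ =
      let u∈ , v∈ , eq = fibre⁻ r uv∈
          u′∈ , v′∈ , eq′ = fibre⁻ r uv′∈
      in product-determined pr w w<p (fixed u∈) (fixed v∈) (fixed u′∈) (fixed v′∈)
           (G-determined pr w (fixed u∈) (fixed u′∈) (same u∈ u′∈))
           (G-determined pr w (fixed v∈) (fixed v′∈) (same v∈ v′∈))
           (trans eq (sym eq′))
    -- All pairs in `T` share the product of the head pair. The first component is therefore a
    -- divisor of that product and determines the second.
    small : ∀ T → Unique T → (∀ {u v} → (u , v) ∈ T → u ∈ S × v ∈ S) →
      (∀ {u v u′ v′} → (u , v) ∈ T → (u′ , v′) ∈ T → u * v ≡ u′ * v′) → length T ≤ b
    small []              _      _  _     = z≤n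
    small T@((u , v) ∷ _) unique ∈S equal = begin
      length T               ≡⟨ length-map proj₁ T ⟨
      length (map proj₁ T)   ≤⟨ unique⊆⇒length≤ (unique-map proj₁-injective unique) T⊆ds ⟩
      length ds              ≤⟨ proj₂ (proj₂ divisors-uv) ⟩
      b                      ∎
      where
      fu : FixedPoint pr w u
      fu = fixed (proj₁ (∈S (here refl)))
      fv : FixedPoint pr w v
      fv = fixed (proj₂ (∈S (here refl)))
      divisors-uv : ∃[ ds ] (ContainsDivisors (u * v) ds × length ds ≤ b)
      divisors-uv = divisors (u * v) {{m*n≢0 u v {{>-nonZero (0<u fu)}} {{>-nonZero (0<u fv)}}}}
        (*-mono-≤ (<⇒≤ (u<p fu)) (<⇒≤ (u<p fv)))
      ds : List ℕ
      ds = proj₁ divisors-uv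
      proj₁-injective : ∀ {x y} → x ∈ T → y ∈ T → proj₁ x ≡ proj₁ y → x ≡ y
      proj₁-injective {x , y} {.x , y′} xy∈ xy′∈ refl = cong (x ,_)
        (*-cancelˡ-≡ y y′ x {{>-nonZero (0<u (fixed (proj₁ (∈S xy∈))))}} (equal xy∈ xy′∈))
      T⊆ds : map proj₁ T ⊆ ds
      T⊆ds x∈ with (x , y) , xy∈ , refl ← ∈-map⁻ proj₁ x∈ =
        proj₁ (proj₂ divisors-uv) (divides y (trans (equal (here refl) xy∈) (*-comm x y)))
    small-fibre : ∀ r → length (fibre f pairs r) ≤ b
    small-fibre r = small (fibre f pairs r) (filter⁺ (λ x → f x ≟ r) pairs-unique)
      (λ uv∈ → let u∈ , v∈ , _ = fibre⁻ r uv∈ in u∈ , v∈) (equal-products r)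

  -- With `w = t * d` and `p ∸ 1 = m * d`, the `m`-th power of `u ^ w` is the `t`-th power of
  -- `u ^ (p ∸ 1)`, and Fermat applies.
  u^w∈rootsOfUnity : ∀ {d m u} → d ∣ w → p ∸ 1 ≡ m * d → FixedPoint pr w u →
    u ^ w % p ∈ rootsOfUnity pr m
  u^w∈rootsOfUnity {d} {m} {u} (divides t w≡) p-1≡ fu = rootsOfUnity⁺ pr {m = m} (m%n<n (u ^ w) p)
    (mod-trans (mod-^ m (mod-trans (mod-% (u ^ w) p) (mod-reflexive (pos-^ u w))))
    (mod-trans (mod-reflexive exponents)
    (mod-trans (mod-^ t (fermat pr (p∤u fu))) (mod-reflexive (ℤ.^-zeroˡ t)))))
    where
    open ≡-Reasoning
    swap : ∀ t d m → t * d * m ≡ m * d * t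
    swap = solve-∀
    exponents : ((+ u) ℤ.^ w) ℤ.^ m ≡ ((+ u) ℤ.^ (p ∸ 1)) ℤ.^ t
    exponents = begin
      ((+ u) ℤ.^ w) ℤ.^ m          ≡⟨ ℤ.^-*-assoc (+ u) w m ⟩
      (+ u) ℤ.^ (w * m)            ≡⟨ cong (λ k → (+ u) ℤ.^ (k * m)) w≡ ⟩
      (+ u) ℤ.^ (t * d * m)        ≡⟨ cong ((+ u) ℤ.^_) (swap t d m) ⟩
      (+ u) ℤ.^ (m * d * t)        ≡⟨ cong (λ k → (+ u) ℤ.^ (k * t)) p-1≡ ⟨
      (+ u) ℤ.^ ((p ∸ 1) * t)      ≡⟨ ℤ.^-*-assoc (+ u) (p ∸ 1) t ⟨
      ((+ u) ℤ.^ (p ∸ 1)) ℤ.^ t    ∎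

  -- There are at most `m = (p - 1) / d` classes, one for each `m`-th root of unity, and each has at
  -- most `r` members, `r` being at least the integer square root of `p * b`.
  F*d≤ : ∀ {N b r d} → N ≤ p → d ∣ w → d ∣ p ∸ 1 →
    (∀ n → .{{NonZero n}} → n ≤ p * p → ∃[ ds ] (ContainsDivisors n ds × length ds ≤ b)) →
    p * b < suc r ^ 2 → F (suc w) N p * d ≤ p * suc r
  F*d≤ {N} {b} {r} {d} N≤p d∣w d∣p-1@(divides m p-1≡) divisors pb<[1+r]² = begin
    -- The extra 1 is for `u = 0`, which lies outside `FixedPoint`.
    F (suc w) N p * d            ≤⟨ *-monoˡ-≤ d (unique⊆⇒length≤ fixedPoints-unique split) ⟩
    suc (length nonzero) * d     ≤⟨ *-monoˡ-≤ d (s≤s length-nonzero) ⟩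
    d + m * r * d                ≡⟨ cong (λ k → d + k) (swap m r d) ⟩
    d + m * d * r                ≡⟨ cong (λ k → d + k * r) p-1≡ ⟨
    -- Since `d ≤ p ∸ 1`, the share of `u = 0` costs at most `p` and turns `r` into `suc r`.
    d + (p ∸ 1) * r              ≤⟨ +-mono-≤ (≤-trans (∣⇒≤ {{p-1≢0}} d∣p-1) (m∸n≤m p 1))
                                      (*-monoˡ-≤ r (m∸n≤m p 1)) ⟩
    p + p * r                    ≡⟨ *-suc p r ⟨
    p * suc r                    ∎
    where
    open ≤-Reasoning
    swap : ∀ m r d → m * r * d ≡ m * d * r
    swap = solve-∀
    p-1≢0 : NonZero (p ∸ 1)
    p-1≢0 = >-nonZero (m<n⇒0<n∸m (nonTrivial⇒n>1 p {{prime⇒nonTrivial pr}}))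
    m≢0 : NonZero m
    m≢0 = m*n≢0⇒m≢0 m {{subst NonZero p-1≡ p-1≢0}}
    fixed? = λ u → q p (suc w) u ≟ u % p
    fixedPoints nonzero : List ℕ
    fixedPoints = filter fixed? (upTo N)
    nonzero = filter (0 <?_) fixedPoints
    fixedPoints-unique : Unique fixedPoints
    fixedPoints-unique = filter⁺ fixed? (upTo⁺ N)
    nonzero-unique : Unique nonzero
    nonzero-unique = filter⁺ (0 <?_) fixedPoints-unique
    split : fixedPoints ⊆ 0 ∷ nonzero
    split {zero}  _  = here refl
    split {suc _} u∈ = there (∈-filter⁺ (0 <?_) u∈ z<s)
    isFixed : ∀ {u} → u ∈ nonzero → FixedPoint pr w u
    isFixed u∈ =
      let u∈fixed , 0<u = ∈-filter⁻ (0 <?_) {xs = fixedPoints} u∈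
          u∈upTo , q≡u  = ∈-filter⁻ fixed? {xs = upTo N} u∈fixed
      in fixedPoint pr w 0<u (<-≤-trans (∈-upTo⁻ u∈upTo) N≤p) q≡u
    class : ℕ → ℕ
    class u = u ^ w % p
    class⁻ : ∀ y {u} → u ∈ fibre class nonzero y → u ∈ nonzero × class u ≡ y
    class⁻ y = ∈-filter⁻ (λ u → class u ≟ y) {xs = nonzero}
    length-class≤ : ∀ y → length (fibre class nonzero y) ≤ r
    length-class≤ y = root-maximal 2 pb<[1+r]² (≤-trans
      (≤-reflexive (cong (length (fibre class nonzero y) *_) (*-identityʳ _)))
      (length-class (fibre class nonzero y) (filter⁺ (λ u → class u ≟ y) nonzero-unique)
        (isFixed ∘ proj₁ ∘ class⁻ y)
        (λ {u} {v} u∈ v∈ → subst₂ (λ a b → a ≡ b [mod + p ]) (pos-^ u w) (pos-^ v w)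
          (%-mod {u ^ w} {v ^ w} (trans (proj₂ (class⁻ y u∈)) (sym (proj₂ (class⁻ y v∈))))))
        divisors))
    length-nonzero : length nonzero ≤ m * r
    length-nonzero = ≤-trans
      (length-fibres class (rootsOfUnity pr m) nonzero nonzero-unique
        (λ u∈ → u^w∈rootsOfUnity {m = m} d∣w p-1≡ (isFixed u∈)) length-class≤)
      (*-monoˡ-≤ r (length-rootsOfUnity pr m {{m≢0}}))

-- Here `ε = a / b`, and raising to the power `2 * b` clears the denominators of the exponent
-- `3/2 + a / b`. A real `ε` is reached through a positive rational below it.
theorem2 : (a b : ℕ) → 1 ≤ a → 1 ≤ b →
    ∃[ C ] ((p w N : ℕ) → .{{_ : NonZero p}} → Prime p → p % 2 ≡ 1 →
    1 ≤ w → w < p → 1 ≤ N → N ≤ p →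
    (F w N p * gcd (w ∸ 1) (p ∸ 1)) ^ (2 * b) ≤ C ^ (2 * b) * p ^ (3 * b + 2 * a))
-- The factor 2 pays for `suc r ≤ r + r`. Taking `suc C₀` makes the constant positive, which gives
-- `1 ≤ t` and `K ≤ K ^ (2 * b)`.
theorem2 a b 1≤a 1≤b with C₀ , bound ← divisorBound b {{>-nonZero 1≤b}} = 2 * suc C₀ , proof
  where
  K = suc C₀
  proof : (p w N : ℕ) → .{{_ : NonZero p}} → Prime p → p % 2 ≡ 1 →
    1 ≤ w → w < p → 1 ≤ N → N ≤ p →
    (F w N p * gcd (w ∸ 1) (p ∸ 1)) ^ (2 * b) ≤ (2 * K) ^ (2 * b) * p ^ (3 * b + 2 * a)
  proof p (suc w) N pr _ _ w<p _ N≤p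
    -- `t` bounds the number of divisors of any positive `n ≤ p * p`, and `r`, the integer square
    -- root of `p * t`, bounds the size of a class.
    with t , t^b≤ , <[1+t]^b ← root b {{>-nonZero 1≤b}} (K * (p * p))
    with r , r²≤ , <[1+r]² ← root 2 (p * t) = begin
      (F (suc w) N p * gcd w (p ∸ 1)) ^ (2 * b) ≤⟨ ^-monoˡ-≤ (2 * b)
        (F*d≤ pr w<p N≤p (gcd[m,n]∣m w (p ∸ 1)) (gcd[m,n]∣n w (p ∸ 1)) divisors <[1+r]²) ⟩
      (p * suc r) ^ (2 * b)                      ≤⟨ ^-monoˡ-≤ (2 * b) (*-monoʳ-≤ p (+-monoˡ-≤ r 1≤r)) ⟩
      (p * (r + r)) ^ (2 * b)                    ≡⟨ ^-*-assoc (p * (r + r)) 2 b ⟨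
      ((p * (r + r)) ^ 2) ^ b                    ≡⟨ cong (_^ b) (square p r) ⟩
      (4 * p ^ 2 * r ^ 2) ^ b                    ≤⟨ ^-monoˡ-≤ b (*-monoʳ-≤ (4 * p ^ 2) r²≤) ⟩
      (4 * p ^ 2 * (p * t)) ^ b                  ≡⟨ cong (_^ b) (cube p t) ⟩
      (2 ^ 2 * p ^ 3 * t) ^ b                    ≡⟨ trans (^-distribʳ-* (2 ^ 2 * p ^ 3) t b)
                                                      (cong (_* t ^ b) (trans (^-distribʳ-* (2 ^ 2) (p ^ 3) b)
                                                        (cong₂ _*_ (^-*-assoc 2 2 b) (^-*-assoc p 3 b)))) ⟩
      2 ^ (2 * b) * p ^ (3 * b) * t ^ b          ≤⟨ *-monoʳ-≤ (2 ^ (2 * b) * p ^ (3 * b)) t^b≤ ⟩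
      -- The divisor bound yields the exponent `1 / b`; `1 ≤ a` weakens it to `a / b`.
      2 ^ (2 * b) * p ^ (3 * b) * (K * (p * p))  ≤⟨ *-monoʳ-≤ (2 ^ (2 * b) * p ^ (3 * b)) (*-mono-≤ K≤ p²≤) ⟩
      2 ^ (2 * b) * p ^ (3 * b) * (K ^ (2 * b) * p ^ (2 * a))
                                                 ≡⟨ swap (2 ^ (2 * b)) (p ^ (3 * b)) (K ^ (2 * b)) (p ^ (2 * a)) ⟩
      2 ^ (2 * b) * K ^ (2 * b) * (p ^ (3 * b) * p ^ (2 * a))
                                                 ≡⟨ cong₂ _*_ (^-distribʳ-* 2 K (2 * b)) (^-distribˡ-+-* p (3 * b) (2 * a)) ⟨
      (2 * K) ^ (2 * b) * p ^ (3 * b + 2 * a)    ∎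
    where
    open ≤-Reasoning
    -- The powers are unfolded to products for the ring solver.
    square : ∀ p r → p * (r + r) * (p * (r + r) * 1) ≡ 4 * (p * (p * 1)) * (r * (r * 1))
    square = solve-∀
    cube : ∀ p t → 4 * (p * (p * 1)) * (p * t) ≡ 4 * (p * (p * (p * 1))) * t
    cube = solve-∀
    swap : ∀ x y z v → x * y * (z * v) ≡ x * z * (y * v)
    swap = solve-∀
    1≤p : 1 ≤ p
    1≤p = >-nonZero⁻¹ p
    1≤t : 1 ≤ t
    1≤t = root-maximal b <[1+t]^b (≤-trans (≤-reflexive (^-zeroˡ b))
      (*-mono-≤ {1} {K} (s≤s z≤n) (*-mono-≤ 1≤p 1≤p)))
    1≤r : 1 ≤ r
    1≤r = root-maximal 2 <[1+r]² (*-mono-≤ 1≤p 1≤t)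
    K≤ : K ≤ K ^ (2 * b)
    K≤ = ≤-trans (≤-reflexive (sym (^-identityʳ K))) (^-monoʳ-≤ K (*-mono-≤ {1} {2} (s≤s z≤n) 1≤b))
    p²≤ : p * p ≤ p ^ (2 * a)
    p²≤ = ≤-trans (≤-reflexive (cong (p *_) (sym (*-identityʳ p)))) (^-monoʳ-≤ p (*-monoʳ-≤ 2 1≤a))
    divisors : ∀ n → .{{NonZero n}} → n ≤ p * p → ∃[ ds ] (ContainsDivisors n ds × length ds ≤ t)
    divisors n n≤p² =
      let ds , complete , small = bound n
      in ds , complete , root-maximal b <[1+t]^b (≤-trans small (*-mono-≤ (n≤1+n C₀) n≤p²))
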